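{- Let $m\ge1$, $T\subseteq\{0,\ldots,m-1\}$, $s=|T|$, and consider the Frobenius-factorized reduction algorithm modulo $g=x^m+\sum_{t\in T}x^t\in\mathbb{F}_2[x]$ described in the context. If $U\ne0$, the algorithm has exactly $$r=\left\lceil\log_2\frac{m}{\Delta_{\min}}\right\rceil$$ sequential feedback stages; if $U=0$, it has none. Thus, for fixed $m$ and $\Delta_{\min}$, the feedback depth is independent of $s$. In a fan-in-two XOR model with free fanout and unrestricted temporary wires, the depth $D_\oplus$ of the complete reduction $A\mapsto A\bmod g$ ($\deg A<2m$) has the upper bound $$D_\oplus\le\sum_{k=0}^{r-1}\left\lceil\log_2(1+h_k)\right\rceil+\left\lceil\log_2(1+s)\right\rceil.$$
   Context: For $t\in T$ put $\Delta_t=m-t$; if $T\neq\varnothing$, $\Delta_{\min}=\min\{\Delta_t:t\in T\}$. For $d\ge 0$, $N^d$ is the truncated right shift on $\mathbb{F}_2^m$: $(N^dy)_i=y_{i+d}$ if $0\le i<m-d$ and $(N^dy)_i=0$ if $m-d\le i<m$; $N^d=0$ for $d\ge m$. Put $U=\sum_{t\in T}N^{\Delta_t}$ and $V(Y)=\sum_{t\in T}(x^tY\bmod x^m)$ for $\deg Y<m$ (polynomials of degree below $m$ are identified with vectors in $\mathbb{F}_2^m$; empty sums are zero). If $U=0$ (equivalently $T\subseteq\{0\}$) set $r=0$; otherwise $r=\lceil\log_2(m/\Delta_{\min})\rceil$, which is also the least nonnegative integer with $U^{2^r}=0$. For $k\ge0$ let $T_k=\{t\in T:2^k\Delta_t<m\}$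 and $h_k=|T_k|$. Frobenius-factorized reduction algorithm on input $A=L+x^mH$ ($\deg L,\deg H<m$): set $Y\leftarrow H$; for $k=0,\ldots,r-1$ synchronously replace $Y$ by $Y+\sum_{t\in T_k}N^{2^k\Delta_t}Y$ (all shifts read the same stage input); return $L+V(Y)$. A feedback stage is one whole synchronous vector update of $Y$, and the feedback depth is the number of sequential feedback stages. Gate depth is measured in circuits of fan-in-two XOR gates whose inputs are the $2m$ coefficients of $A$ and whose outputs are the $m$ coefficients of $A\bmod g$, with free fanout and no restriction on the number of wires; $D_\oplus$ is the depth attainable for realizing the complete reduction. -}

module Defs where

open import Data.Bool using (Bool; true; false; _∧_; _xor_; if_then_else_)
import Data.Bool.Properties as Bool
open import Data.Fin using (Fin; zero; suc; toℕ)
open import Data.Fin.Properties using (toℕ<n)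
open import Data.Fin.Subset using (Subset; inside; outside)
open import Data.Fin.Subset.Properties using (anySubset?)
open import Data.Integer as ℤ using (+_; -[1+_])
import Data.Integer.Properties as ℤ
open import Data.List using (List; []; _∷_; length; map; foldl; upTo)
open import Data.Nat using (ℕ; zero; suc; _+_; _*_; _∸_; _^_; _≤_; _<_; _<?_; _⊓_; _⊔_; NonZero; z≤n; s≤s; >-nonZero; >-nonZero⁻¹)
open import Data.Nat.Properties using (⊓-glb; m<n⇒0<n∸m; ≤-trans; m≤m*n; +-mono-≤; m≤m+n; m^n>0)
open import Data.Product using (∃; _×_; _,_; proj₁; proj₂)
open import Data.Rational.Unnormalised as ℚᵘ using (ℚᵘ; mkℚᵘ; *≤*; ↥_)
import Data.Rational.Unnormalised.Properties as ℚᵘ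
open import Data.Vec as Vec using (Vec; []; _∷_; lookup; tabulate; replicate; zipWith; toList)
open import Data.Vec.Properties using (≡-dec)
open import Function using (_∘_)
open import Relation.Binary.PropositionalEquality using (_≡_; subst)
open import Relation.Nullary using (Dec; yes; no; does; contradiction; ¬?)
open import Relation.Nullary.Decidable using (map′; ⌊_⌋; decidable-stable)
open import Relation.Unary using (Decidable)

foldOver : ∀ {A : Set} {n} → (A → A → A) → A → Subset n → (Fin n → A) → A
foldOver _∙_ ε []            f = ε
foldOver _∙_ ε (inside  ∷ S) f = f zero ∙ foldOver _∙_ ε S (f ∘ suc)
foldOver _∙_ ε (outside ∷ S) f = foldOver _∙_ ε S (f ∘ suc)

------------------------------------------------------------------------
-- Polynomials over 𝔽₂: 𝔽₂ is Bool with _xor_ and _∧_; a polynomial is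
-- the list of its coefficients, constant term first. Trailing zeros are
-- allowed, so equality of polynomials is _≈ᴾ_.

𝔽₂[x] : Set
𝔽₂[x] = List Bool

coeff : 𝔽₂[x] → ℕ → Bool
coeff []      _       = false
coeff (a ∷ p) zero    = a
coeff (a ∷ p) (suc i) = coeff p i

infix  4 _≈ᴾ_
infixl 6 _+ᴾ_
infixl 7 _*ᴾ_

_≈ᴾ_ : 𝔽₂[x] → 𝔽₂[x] → Set
p ≈ᴾ q = ∀ i → coeff p i ≡ coeff q i

_+ᴾ_ : 𝔽₂[x] → 𝔽₂[x] → 𝔽₂[x]
[]      +ᴾ q       = q
(a ∷ p) +ᴾ []      = a ∷ p
(a ∷ p) +ᴾ (b ∷ q) = (a xor b) ∷ (p +ᴾ q)

_*ᴾ_ : 𝔽₂[x] → 𝔽₂[x] → 𝔽₂[x]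
[]      *ᴾ q = []
(a ∷ p) *ᴾ q = map (a ∧_) q +ᴾ (false ∷ (p *ᴾ q))

x^_ : ℕ → 𝔽₂[x]
x^ zero  = true ∷ []
x^ suc n = false ∷ x^ n

------------------------------------------------------------------------
-- A vector in 𝔽₂^ m is also the polynomial toList y of degree below m.

𝔽₂^_ : ℕ → Set
𝔽₂^ m = Vec Bool m

infixl 6 _⊕_

_⊕_ : ∀ {m} → 𝔽₂^ m → 𝔽₂^ m → 𝔽₂^ m
_⊕_ = zipWith _xor_

𝟎 : ∀ {m} → 𝔽₂^ m
𝟎 = replicate _ false

_modx^_ : 𝔽₂[x] → ∀ m → 𝔽₂^ m
p modx^ m = tabulate (λ i → coeff p (toℕ i))

IsRemainder : ∀ {m} → 𝔽₂[x] → 𝔽₂[x] → 𝔽₂^ m → Set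
IsRemainder A g R = ∃ λ Q → A ≈ᴾ Q *ᴾ g +ᴾ toList R

-- coeff vanishes beyond the length of its list, so entries i with
-- i + d ≥ m are zero, and N^ d is zero for d ≥ m.
N^_ : ℕ → ∀ {m} → 𝔽₂^ m → 𝔽₂^ m
(N^ d) y = tabulate (λ i → coeff (toList y) (toℕ i + d))

------------------------------------------------------------------------
-- The rational ceiling logarithm. As log₂ q ≤ k means q ≤ 2 ^ k, ⌈log₂ q⌉
-- is the least such k. Ranging over k : ℕ is the ceiling in ℤ when q ≥ 1,
-- which holds for the ratios m / Δmin to which it is applied.

IsCeilLog₂ : ℚᵘ → ℕ → Set
IsCeilLog₂ q r = Bounds r × (∀ k → Bounds k → r ≤ k)
  where
  Bounds : ℕ → Set
  Bounds k = q ℚᵘ.≤ + (2 ^ k) ℚᵘ./ 1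

private
  least : ∀ {P : ℕ → Set} → Decidable P → ∀ n → P n →
          ∃ λ r → P r × (∀ k → P k → r ≤ k)
  least P? zero Pn = zero , Pn , λ _ _ → z≤n
  least {P} P? (suc n) Pn with P? zero
  ... | yes P0 = zero , P0 , λ _ _ → z≤n
  ... | no ¬P0 with least (P? ∘ suc) n Pn
  ...   | r , Pr , r-least = suc r , Pr , minimal
    where
    minimal : ∀ k → P k → suc r ≤ k
    minimal zero    P0 = contradiction P0 ¬P0
    minimal (suc k) Pk = s≤s (r-least k Pk)

  n≤2^n : ∀ n → n ≤ 2 ^ n
  n≤2^n zero    = z≤n
  n≤2^n (suc n) = +-mono-≤ (m^n>0 2 n) (≤-trans (n≤2^n n) (m≤m+n (2 ^ n) 0))

  bounded : ∀ q → q ℚᵘ.≤ + (2 ^ ℤ.∣ ↥ q ∣) ℚᵘ./ 1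
  bounded (mkℚᵘ (+ n) d) = *≤* (ℤ.≤-trans (ℤ.≤-reflexive (ℤ.*-identityʳ (+ n)))
    (ℤ.≤-trans (ℤ.+≤+ (≤-trans (n≤2^n n) (m≤m*n (2 ^ n) (suc d))))
               (ℤ.≤-reflexive (ℤ.pos-* (2 ^ n) (suc d)))))
  bounded (mkℚᵘ -[1+ n ] d) =
    *≤* (subst (ℤ._≤_ _) (ℤ.pos-* (2 ^ suc n) (suc d)) ℤ.-≤+)

ceilLog₂ : ∀ q → ∃ (IsCeilLog₂ q)
ceilLog₂ q = least (λ k → q ℚᵘ.≤? + (2 ^ k) ℚᵘ./ 1) ℤ.∣ ↥ q ∣ (bounded q)

⌈log₂ᵘ_⌉ : ℚᵘ → ℕ
⌈log₂ᵘ q ⌉ = proj₁ (ceilLog₂ q)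

------------------------------------------------------------------------

Δ : ∀ {m} → Fin m → ℕ
Δ {m} t = m ∸ toℕ t

-- Every Δ t is at most m, so the initial value m does not affect the
-- minimum over a nonempty T; for empty T the value m is not meaningful.
Δmin : ∀ {m} → Subset m → ℕ
Δmin {m} T = foldOver _⊓_ m T Δ

private
  foldOver-⊓-pos : ∀ {n} (S : Subset n) (f : Fin n → ℕ) {ε} →
                   0 < ε → (∀ i → 0 < f i) → 0 < foldOver _⊓_ ε S f
  foldOver-⊓-pos []            f ε>0 f>0 = ε>0
  foldOver-⊓-pos (inside  ∷ S) f ε>0 f>0 =
    ⊓-glb (f>0 zero) (foldOver-⊓-pos S (f ∘ suc) ε>0 (f>0 ∘ suc))
  foldOver-⊓-pos (outside ∷ S) f ε>0 f>0 =
    foldOver-⊓-pos S (f ∘ suc) ε>0 (f>0 ∘ suc)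

Δmin-nonZero : ∀ {m} .{{_ : NonZero m}} (T : Subset m) → NonZero (Δmin T)
Δmin-nonZero {m} T = >-nonZero
  (foldOver-⊓-pos T Δ (>-nonZero⁻¹ m) (λ t → m<n⇒0<n∸m (toℕ<n t)))

m/Δmin : ∀ {m} .{{_ : NonZero m}} → Subset m → ℚᵘ
m/Δmin {m} T = (+ m ℚᵘ./ Δmin T) {{Δmin-nonZero T}}

modulus : ∀ {m} → Subset m → 𝔽₂[x]
modulus {m} T = x^ m +ᴾ foldOver _+ᴾ_ [] T (λ t → x^ toℕ t)

U : ∀ {m} → Subset m → 𝔽₂^ m → 𝔽₂^ m
U T y = foldOver _⊕_ 𝟎 T (λ t → (N^ Δ t) y)

V : ∀ {m} → Subset m → 𝔽₂^ m → 𝔽₂^ m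
V {m} T Y = foldOver _⊕_ 𝟎 T (λ t → (x^ toℕ t *ᴾ toList Y) modx^ m)

IsZero : ∀ {m} → (𝔽₂^ m → 𝔽₂^ m) → Set
IsZero f = ∀ y → f y ≡ 𝟎

isZero? : ∀ {m} (f : 𝔽₂^ m → 𝔽₂^ m) → Dec (IsZero f)
isZero? f = map′
  (λ ¬∃ y → decidable-stable (f y ≟ 𝟎) (λ fy≢𝟎 → ¬∃ (y , fy≢𝟎)))
  (λ f≡𝟎 (y , fy≢𝟎) → fy≢𝟎 (f≡𝟎 y))
  (¬? (anySubset? (λ y → ¬? (f y ≟ 𝟎))))
  where _≟_ = ≡-dec Bool._≟_

r : ∀ {m} .{{_ : NonZero m}} → Subset m → ℕ
r T = if does (isZero? (U T)) then 0 else ⌈log₂ᵘ m/Δmin T ⌉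

T[_] : ∀ {m} → ℕ → Subset m → Subset m
T[_] {m} k T = tabulate (λ t → lookup T t ∧ ⌊ 2 ^ k * Δ t <? m ⌋)

------------------------------------------------------------------------
-- Reduction algorithms: on input L + x^m H the register Y starts at H, is
-- updated by the feedback stages in sequence, each a whole synchronous
-- vector update, and the output is computed from L and the final Y.

record Algorithm (m : ℕ) : Set where
  field
    stages : List (𝔽₂^ m → 𝔽₂^ m)
    output : 𝔽₂^ m → 𝔽₂^ m → 𝔽₂^ m

  run : 𝔽₂^ m → 𝔽₂^ m → 𝔽₂^ m
  run L H = output L (foldl (λ Y stage → stage Y) H stages)

  feedbackDepth : ℕ
  feedbackDepth = length stages

open Algorithm public using (run; feedbackDepth)

frobenius : ∀ {m} .{{_ : NonZero m}} → Subset m → Algorithm m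
frobenius T = record
  { stages = map (λ k Y → Y ⊕ foldOver _⊕_ 𝟎 (T[ k ] T) (λ t → (N^ (2 ^ k * Δ t)) Y))
                 (upTo (r T))
  ; output = λ L Y → L ⊕ V T Y
  }

------------------------------------------------------------------------
-- Circuits of fan-in-two XOR gates. Gates n w is a straight-line netlist
-- with n inputs and w wires; the newest wire has index zero, and a wire
-- may be read any number of times. There are no constant wires.

data Gates (n : ℕ) : ℕ → Set where
  inputs : Gates n n
  gate   : ∀ {w} → Gates n w → Fin w → Fin w → Gates n (suc w)

values : ∀ {n w} → Gates n w → Vec Bool n → Vec Bool w
values inputs         a = a
values (gate gs i j) a = (lookup (values gs a) i xor lookup (values gs a) j) ∷ values gs a

levels : ∀ {n w} → Gates n w → Vec ℕ w
levels inputs         = replicate _ 0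
levels (gate gs i j) = suc (lookup (levels gs) i ⊔ lookup (levels gs) j) ∷ levels gs

record Circuit (n o : ℕ) : Set where
  field
    {wires} : ℕ
    gates   : Gates n wires
    outputs : Vec (Fin wires) o

  eval : Vec Bool n → Vec Bool o
  eval a = Vec.map (lookup (values gates a)) outputs

  depth : ℕ
  depth = Vec.foldr′ _⊔_ 0 (Vec.map (lookup (levels gates)) outputs)

open Circuit public using (eval; depth)

RealizesReduction : ∀ {m} → Subset m → Circuit (m + m) m → Set
RealizesReduction T C = ∀ A → IsRemainder (toList A) (modulus T) (eval C A)

-- D⊕ is the depth attainable by circuits for A ↦ A mod g, so that D⊕ ≤ d
-- says that some circuit realizing the reduction has depth at most d.
D⊕[_]≤_ : ∀ {m} → Subset m → ℕ → Set
D⊕[ T ]≤ d = ∃ λ C → RealizesReduction T C × depth C ≤ d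

{-# OPTIONS --safe #-}

-- Let U = Σ N^(m − t). Since U has characteristic two and commuting summands,
-- U^(2^k) = Σ N^(2^k (m − t)), so the k-th stage applies I + U^(2^k) and the
-- stages together apply the inverse of I + U, as U^(2^r) = 0. The final
-- register Y satisfies x^m H = Y·g + V(Y), so it is the quotient of L + x^m H
-- by g, and L + V(Y) the remainder. U = 0 forces Δmin = m, so the formula for
-- r holds in that case too. For the depth, each entry of a stage is an xor of
-- the old entry and at most h_k others, computed by a balanced tree; the gate
-- count is unrestricted, so nothing has to be shared between entries.

module Submission where

open import Defs
open import Data.Fin.Subset using (Subset; Nonempty; ∣_∣)
open import Data.List using (map; upTo)
open import Data.Nat using (ℕ; _+_; NonZero)
open import Data.Nat.ListAction using (sum)
open import Data.Nat.Logarithm using (⌈log₂_⌉)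
open import Data.Product using (_×_)
open import Relation.Binary.PropositionalEquality using (_≡_)
open import Relation.Nullary using (¬_)

open import Algebra.Bundles using (CommutativeRing)
open import Data.Bool using (Bool; true; false; _∧_; _xor_; if_then_else_)
open import Data.Bool.Properties
  using (xor-comm; xor-assoc; xor-same; xor-identityʳ; ∧-distribˡ-xor; ∧-identityʳ; ∧-zeroʳ;
         xor-∧-commutativeRing)
open import Data.Fin using (Fin; zero; suc; toℕ; fromℕ<)
open import Data.Fin.Properties using (toℕ<n; toℕ-injective; toℕ-fromℕ<)
open import Data.Fin.Subset using (inside; outside; _∈_)
import Data.Integer as ℤ
import Data.Integer.Properties as ℤ
open import Data.List using (List; []; _∷_; _∷ʳ_; foldl; length)
open import Data.List.Properties using (foldl-∷ʳ; length-map; length-upTo; map-++; upTo-∷ʳ)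
open import Data.List.Relation.Unary.All using (All; []; _∷_)
open import Data.Nat
  using (zero; suc; _*_; _∸_; _^_; _⊓_; _⊔_; _≤_; _<_; _<?_; ⌈_/2⌉; z≤n; s≤s; z<s; s<s)
open import Data.Nat.ListAction.Properties using (sum-++)
open import Data.Nat.Logarithm using (⌈log₂⌉-mono-≤; ⌈log₂⌈n/2⌉⌉≡⌈log₂n⌉∸1)
open import Data.Nat.Properties
open import Data.Product using (∃; ∃₂; _,_; proj₁; proj₂)
open import Data.Rational.Unnormalised as ℚᵘ using (*≤*)
open import Data.Sum using (_⊎_; inj₁; inj₂)
open import Data.Vec as Vec using (Vec; []; _∷_; here; there; lookup; tabulate; toList; take; drop)
open import Data.Vec.Properties
  using (lookup-map; lookup-replicate; lookup-zipWith; lookup∘tabulate; tabulate∘lookup; tabulate-cong;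
         take++drop≡id)
open import Function using (_∘_)
open import Relation.Binary.PropositionalEquality
  using (_≢_; _≗_; refl; sym; trans; cong; cong₂; subst; module ≡-Reasoning)
open import Relation.Nullary using (Dec; yes; no; contradiction; does)
open import Relation.Nullary.Decidable using (⌊_⌋; dec-true)

open import Algebra.Properties.CommutativeSemigroup
  (CommutativeRing.+-commutativeSemigroup xor-∧-commutativeRing)
  using () renaming (interchange to xor-interchange)
open import Algebra.Properties.CommutativeSemigroup +-commutativeSemigroup
  using () renaming (xy∙z≈xz∙y to +-swapʳ)

xor-cancel-middle : ∀ a b c → (a xor b) xor (b xor c) ≡ a xor c
xor-cancel-middle a b c = begin
  (a xor b) xor (b xor c)  ≡⟨ xor-assoc a b (b xor c) ⟩
  a xor (b xor (b xor c))  ≡⟨ cong (a xor_) (xor-assoc b b c) ⟨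
  a xor ((b xor b) xor c)  ≡⟨ cong (λ z → a xor (z xor c)) (xor-same b) ⟩
  a xor c                  ∎
  where open ≡-Reasoning

-- Sums over subsets

foldOver-cong : ∀ {A : Set} {n} {_∙_ : A → A → A} {ε} (S : Subset n) {f g : Fin n → A} →
                f ≗ g → foldOver _∙_ ε S f ≡ foldOver _∙_ ε S g
foldOver-cong []            f≗g = refl
foldOver-cong {_∙_ = _∙_} (inside  ∷ S) f≗g = cong₂ _∙_ (f≗g zero) (foldOver-cong S (f≗g ∘ suc))
foldOver-cong (outside ∷ S) f≗g = foldOver-cong S (f≗g ∘ suc)

-- With `h` reading off a single entry, this turns a fold of vectors or polynomials into a sum in
-- 𝔽₂.
foldOver-homo : ∀ {A B : Set} {n} {_∙_ : A → A → A} {ε} {_◦_ : B → B → B} {ε′} (h : A → B) →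
                (∀ x y → h (x ∙ y) ≡ h x ◦ h y) → h ε ≡ ε′ →
                (S : Subset n) (f : Fin n → A) →
                h (foldOver _∙_ ε S f) ≡ foldOver _◦_ ε′ S (h ∘ f)
foldOver-homo h h-∙ h-ε []            f = h-ε
foldOver-homo {_◦_ = _◦_} h h-∙ h-ε (inside  ∷ S) f =
  trans (h-∙ _ _) (cong (h (f zero) ◦_) (foldOver-homo h h-∙ h-ε S (f ∘ suc)))
foldOver-homo h h-∙ h-ε (outside ∷ S) f = foldOver-homo h h-∙ h-ε S (f ∘ suc)

foldOver-⊓-≤ : ∀ {n} {S : Subset n} {f : Fin n → ℕ} {ε t} → t ∈ S → foldOver _⊓_ ε S f ≤ f t
foldOver-⊓-≤                   here        = m⊓n≤m _ _
foldOver-⊓-≤ {S = inside  ∷ S} (there t∈S) = ≤-trans (m⊓n≤n _ _) (foldOver-⊓-≤ t∈S)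
foldOver-⊓-≤ {S = outside ∷ S} (there t∈S) = foldOver-⊓-≤ t∈S

foldOver-⊓-glb : ∀ {n} (S : Subset n) {f : Fin n → ℕ} {ε d} →
                 d ≤ ε → (∀ {t} → t ∈ S → d ≤ f t) → d ≤ foldOver _⊓_ ε S f
foldOver-⊓-glb []            d≤ε d≤f = d≤ε
foldOver-⊓-glb (inside  ∷ S) d≤ε d≤f = ⊓-glb (d≤f here) (foldOver-⊓-glb S d≤ε (d≤f ∘ there))
foldOver-⊓-glb (outside ∷ S) d≤ε d≤f = foldOver-⊓-glb S d≤ε (d≤f ∘ there)

∑ : ∀ {n} → Subset n → (Fin n → Bool) → Bool
∑ = foldOver _xor_ false

∑-vanish : ∀ {n} (S : Subset n) {f : Fin n → Bool} → (∀ {t} → t ∈ S → f t ≡ false) → ∑ S f ≡ false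
∑-vanish []            f≡0 = refl
∑-vanish (inside  ∷ S) f≡0 = cong₂ _xor_ (f≡0 here) (∑-vanish S (f≡0 ∘ there))
∑-vanish (outside ∷ S) f≡0 = ∑-vanish S (f≡0 ∘ there)

∑-single : ∀ {n} {S : Subset n} {f : Fin n → Bool} {t} → t ∈ S →
           f t ≡ true → (∀ s → s ≢ t → f s ≡ false) → ∑ S f ≡ true
∑-single {S = inside ∷ S} here ft≡1 f≡0 =
  cong₂ _xor_ ft≡1 (∑-vanish S (λ {s} _ → f≡0 (suc s) λ ()))
∑-single {S = inside ∷ S} (there t∈S) ft≡1 f≡0 =
  cong₂ _xor_ (f≡0 zero λ ()) (∑-single t∈S ft≡1 λ s s≢t → f≡0 (suc s) λ { refl → s≢t refl })
∑-single {S = outside ∷ S} (there t∈S) ft≡1 f≡0 =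
  ∑-single t∈S ft≡1 λ s s≢t → f≡0 (suc s) λ { refl → s≢t refl }

-- `T[ k ] T` is a subset of this form; the terms it discards are shifts by at least m, which
-- vanish.
∑-filter : ∀ {n} (S : Subset n) (b : Fin n → Bool) {f : Fin n → Bool} →
           (∀ t → b t ≡ false → f t ≡ false) → ∑ (tabulate (λ t → lookup S t ∧ b t)) f ≡ ∑ S f
∑-filter []            b f≡0 = refl
∑-filter (outside ∷ S) b f≡0 = ∑-filter S (b ∘ suc) (f≡0 ∘ suc)
∑-filter (inside  ∷ S) b {f} f≡0 with b zero in b₀
... | true  = cong (f zero xor_) (∑-filter S (b ∘ suc) (f≡0 ∘ suc))
... | false = trans (∑-filter S (b ∘ suc) (f≡0 ∘ suc)) (cong (_xor ∑ S (f ∘ suc)) (sym (f≡0 zero b₀)))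

∑-xor : ∀ {n} (S : Subset n) (f g : Fin n → Bool) → ∑ S (λ t → f t xor g t) ≡ ∑ S f xor ∑ S g
∑-xor []            f g = refl
∑-xor (inside  ∷ S) f g = trans (cong ((f zero xor g zero) xor_) (∑-xor S (f ∘ suc) (g ∘ suc)))
                                (xor-interchange (f zero) (g zero) _ _)
∑-xor (outside ∷ S) f g = ∑-xor S (f ∘ suc) (g ∘ suc)

∑-swap : ∀ {m n} (S : Subset m) (S′ : Subset n) (F : Fin m → Fin n → Bool) →
         ∑ S (λ s → ∑ S′ (F s)) ≡ ∑ S′ (λ t → ∑ S (λ s → F s t))
∑-swap []            S′ F = sym (∑-vanish S′ λ _ → refl)
∑-swap (inside  ∷ S) S′ F =
  trans (cong (∑ S′ (F zero) xor_) (∑-swap S S′ (F ∘ suc))) (sym (∑-xor S′ _ _))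
∑-swap (outside ∷ S) S′ F = ∑-swap S S′ (F ∘ suc)

-- Over 𝔽₂ the off-diagonal terms of a symmetric double sum cancel in pairs.
∑-diagonal : ∀ {n} (S : Subset n) (F : Fin n → Fin n → Bool) → (∀ s t → F s t ≡ F t s) →
             ∑ S (λ s → ∑ S (F s)) ≡ ∑ S (λ s → F s s)
∑-diagonal []            F F-sym = refl
∑-diagonal (outside ∷ S) F F-sym = ∑-diagonal S _ λ s t → F-sym (suc s) (suc t)
∑-diagonal (inside  ∷ S) F F-sym = begin
  (F zero zero xor row) xor ∑ S (λ s → F (suc s) zero xor ∑ S (F (suc s) ∘ suc))
    ≡⟨ cong ((F zero zero xor row) xor_) (∑-xor S _ _) ⟩
  (F zero zero xor row) xor (∑ S (λ s → F (suc s) zero) xor ∑ S (λ s → ∑ S (F (suc s) ∘ suc)))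
    ≡⟨ cong₂ (λ a b → (F zero zero xor row) xor (a xor b))
             (foldOver-cong S λ s → F-sym (suc s) zero)
             (∑-diagonal S _ λ s t → F-sym (suc s) (suc t)) ⟩
  (F zero zero xor row) xor (row xor ∑ S (λ s → F (suc s) (suc s)))
    ≡⟨ xor-cancel-middle (F zero zero) row _ ⟩
  F zero zero xor ∑ S (λ s → F (suc s) (suc s))
    ∎
  where
  open ≡-Reasoning
  row = ∑ S (F zero ∘ suc)

-- The operators I + Σ N^e on coefficient sequences

-- Acting on sequences indexed by all of ℕ makes the exponents of composed shifts simply add.
-- Truncation is recovered because the coefficients of a vector vanish from index m on.
addShifts : ∀ {n} → Subset n → (Fin n → ℕ) → (ℕ → Bool) → ℕ → Bool
addShifts S e f i = f i xor ∑ S (λ t → f (i + e t))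

addShifts-cong : ∀ {n} (S : Subset n) (e : Fin n → ℕ) {f g} → f ≗ g → addShifts S e f ≗ addShifts S e g
addShifts-cong S e f≗g i = cong₂ _xor_ (f≗g i) (foldOver-cong S λ t → f≗g (i + e t))

addShifts-cong-e : ∀ {n} (S : Subset n) {e e′ : Fin n → ℕ} f → e ≗ e′ → addShifts S e f ≗ addShifts S e′ f
addShifts-cong-e S f e≗e′ i = cong (f i xor_) (foldOver-cong S λ t → cong (λ d → f (i + d)) (e≗e′ t))

-- The expansion (I + A)(I + B) = (I + B) + (A + AB), bracketed so that `xor-interchange` or
-- `xor-cancel-middle` applies directly.
addShifts² : ∀ {n} (S : Subset n) (e e′ : Fin n → ℕ) f i →
             addShifts S e (addShifts S e′ f) i ≡
             (f i xor ∑ S (λ t → f (i + e′ t))) xor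
             (∑ S (λ t → f (i + e t)) xor ∑ S (λ s → ∑ S (λ t → f (i + e s + e′ t))))
addShifts² S e e′ f i = cong ((f i xor ∑ S (λ t → f (i + e′ t))) xor_) (∑-xor S _ _)

-- The linear terms trade places, and exchanging the two sums in the quadratic term matches it up
-- because exponents add commutatively.
addShifts-comm : ∀ {n} (S : Subset n) (e e′ : Fin n → ℕ) f →
                 addShifts S e (addShifts S e′ f) ≗ addShifts S e′ (addShifts S e f)
addShifts-comm S e e′ f i = begin
  addShifts S e (addShifts S e′ f) i  ≡⟨ addShifts² S e e′ f i ⟩
  (f i xor a′) xor (a xor ∑ S (λ s → ∑ S (λ t → f (i + e s + e′ t))))
    ≡⟨ cong (λ z → (f i xor a′) xor (a xor z))
         (trans (∑-swap S S _)
                (foldOver-cong S λ t → foldOver-cong S λ s → cong f (+-swapʳ i (e s) (e′ t)))) ⟩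
  (f i xor a′) xor (a xor ∑ S (λ t → ∑ S (λ s → f (i + e′ t + e s))))
    ≡⟨ xor-interchange (f i) a′ a _ ⟩
  (f i xor a) xor (a′ xor ∑ S (λ t → ∑ S (λ s → f (i + e′ t + e s))))
    ≡⟨ addShifts² S e′ e f i ⟨
  addShifts S e′ (addShifts S e f) i  ∎
  where
  open ≡-Reasoning
  a a′ : Bool
  a  = ∑ S (λ t → f (i + e t))
  a′ = ∑ S (λ t → f (i + e′ t))

-- Frobenius in characteristic two: the two copies of the linear term cancel, and the quadratic term
-- collapses to its diagonal.
addShifts-square : ∀ {n} (S : Subset n) (e : Fin n → ℕ) f →
                   addShifts S e (addShifts S e f) ≗ addShifts S (λ t → e t + e t) f
addShifts-square S e f i = begin
  addShifts S e (addShifts S e f) i  ≡⟨ addShifts² S e e f i ⟩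
  (f i xor a) xor (a xor ∑ S (λ s → ∑ S (λ t → f (i + e s + e t))))
    ≡⟨ xor-cancel-middle (f i) a _ ⟩
  f i xor ∑ S (λ s → ∑ S (λ t → f (i + e s + e t)))
    ≡⟨ cong (f i xor_) (∑-diagonal S _ λ s t → cong f (+-swapʳ i (e s) (e t))) ⟩
  f i xor ∑ S (λ t → f (i + e t + e t))
    ≡⟨ cong (f i xor_) (foldOver-cong S λ t → cong f (+-assoc i (e t) (e t))) ⟩
  f i xor ∑ S (λ t → f (i + (e t + e t)))
    ∎
  where
  open ≡-Reasoning
  a = ∑ S (λ t → f (i + e t))

-- Coefficients of vectors and polynomials

coeffs : ∀ {m} → 𝔽₂^ m → ℕ → Bool
coeffs y = coeff (toList y)

vec-ext : ∀ {A : Set} {n} {u v : Vec A n} → lookup u ≗ lookup v → u ≡ v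
vec-ext {u = u} {v} u≗v = trans (sym (tabulate∘lookup u)) (trans (tabulate-cong u≗v) (tabulate∘lookup v))

coeffs-toℕ : ∀ {m} (y : 𝔽₂^ m) (i : Fin m) → coeffs y (toℕ i) ≡ lookup y i
coeffs-toℕ (a ∷ y) zero    = refl
coeffs-toℕ (a ∷ y) (suc i) = coeffs-toℕ y i

coeffs-≥ : ∀ {m i} (y : 𝔽₂^ m) → m ≤ i → coeffs y i ≡ false
coeffs-≥ []      _         = refl
coeffs-≥ (a ∷ y) (s≤s m≤i) = coeffs-≥ y m≤i

coeffs-tabulate : ∀ {m i} (f : ℕ → Bool) → i < m → coeffs (tabulate {n = m} (f ∘ toℕ)) i ≡ f i
coeffs-tabulate f z<s       = refl
coeffs-tabulate f (s<s i<m@(s≤s _)) = coeffs-tabulate (f ∘ suc) i<m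

coeffs-⊕ : ∀ {m} i (y z : 𝔽₂^ m) → coeffs (y ⊕ z) i ≡ coeffs y i xor coeffs z i
coeffs-⊕ i       []      []      = refl
coeffs-⊕ zero    (a ∷ y) (b ∷ z) = refl
coeffs-⊕ (suc i) (a ∷ y) (b ∷ z) = coeffs-⊕ i y z

coeffs-𝟎 : ∀ m i → coeffs (𝟎 {m}) i ≡ false
coeffs-𝟎 zero    i       = refl
coeffs-𝟎 (suc m) zero    = refl
coeffs-𝟎 (suc m) (suc i) = coeffs-𝟎 m i

coeffs-⨁ : ∀ {m n} i (S : Subset n) (f : Fin n → 𝔽₂^ m) →
           coeffs (foldOver _⊕_ 𝟎 S f) i ≡ ∑ S (λ t → coeffs (f t) i)
coeffs-⨁ {m} i = foldOver-homo (λ y → coeffs y i) (coeffs-⊕ i) (coeffs-𝟎 m i)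

lookup-⊕-⨁ : ∀ {m k} (S : Subset k) (y : 𝔽₂^ m) (f : Fin k → 𝔽₂^ m) i →
             lookup (y ⊕ foldOver _⊕_ 𝟎 S f) i ≡ lookup y i xor ∑ S (λ t → lookup (f t) i)
lookup-⊕-⨁ S y f i = trans (lookup-zipWith _xor_ i y _) (cong (lookup y i xor_)
  (foldOver-homo (λ z → lookup z i) (lookup-zipWith _xor_ i) (lookup-replicate i false) S f))

-- For i ≥ m both sides vanish, so on coefficient sequences the truncated shift is a plain index
-- translation.
coeffs-N : ∀ {m} d (y : 𝔽₂^ m) i → coeffs ((N^ d) y) i ≡ coeffs y (i + d)
coeffs-N {m} d y i with i <? m
... | yes i<m = coeffs-tabulate (λ j → coeffs y (j + d)) i<m
... | no  i≮m = trans (coeffs-≥ ((N^ d) y) m≤i) (sym (coeffs-≥ y (≤-trans m≤i (m≤m+n i d))))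
  where m≤i = ≮⇒≥ i≮m

coeff-+ᴾ : ∀ i p q → coeff (p +ᴾ q) i ≡ coeff p i xor coeff q i
coeff-+ᴾ i       []      q       = refl
coeff-+ᴾ i       (a ∷ p) []      = sym (xor-identityʳ _)
coeff-+ᴾ zero    (a ∷ p) (b ∷ q) = refl
coeff-+ᴾ (suc i) (a ∷ p) (b ∷ q) = coeff-+ᴾ i p q

coeff-map-∧ : ∀ a p i → coeff (map (a ∧_) p) i ≡ a ∧ coeff p i
coeff-map-∧ a []      i       = sym (∧-zeroʳ a)
coeff-map-∧ a (b ∷ p) zero    = refl
coeff-map-∧ a (b ∷ p) (suc i) = coeff-map-∧ a p i

coeff-∷-* : ∀ a p q i → coeff ((a ∷ p) *ᴾ q) i ≡ (a ∧ coeff q i) xor coeff (false ∷ p *ᴾ q) i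
coeff-∷-* a p q i = trans (coeff-+ᴾ i (map (a ∧_) q) _) (cong (_xor _) (coeff-map-∧ a q i))

coeff-*-+ᴾ : ∀ p i q s → coeff (p *ᴾ (q +ᴾ s)) i ≡ coeff (p *ᴾ q) i xor coeff (p *ᴾ s) i
coeff-*-+ᴾ []      i q s = refl
coeff-*-+ᴾ (a ∷ p) i q s = begin
  coeff ((a ∷ p) *ᴾ (q +ᴾ s)) i
    ≡⟨ coeff-∷-* a p (q +ᴾ s) i ⟩
  (a ∧ coeff (q +ᴾ s) i) xor coeff (false ∷ p *ᴾ (q +ᴾ s)) i
    ≡⟨ cong₂ _xor_ (trans (cong (a ∧_) (coeff-+ᴾ i q s)) (∧-distribˡ-xor a _ _)) (tails i) ⟩
  ((a ∧ coeff q i) xor (a ∧ coeff s i)) xor (coeff (false ∷ p *ᴾ q) i xor coeff (false ∷ p *ᴾ s) i)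
    ≡⟨ xor-interchange (a ∧ coeff q i) _ _ _ ⟩
  ((a ∧ coeff q i) xor coeff (false ∷ p *ᴾ q) i) xor ((a ∧ coeff s i) xor coeff (false ∷ p *ᴾ s) i)
    ≡⟨ cong₂ _xor_ (coeff-∷-* a p q i) (coeff-∷-* a p s i) ⟨
  coeff ((a ∷ p) *ᴾ q) i xor coeff ((a ∷ p) *ᴾ s) i
    ∎
  where
  open ≡-Reasoning
  tails : ∀ i → coeff (false ∷ p *ᴾ (q +ᴾ s)) i ≡
                coeff (false ∷ p *ᴾ q) i xor coeff (false ∷ p *ᴾ s) i
  tails zero    = refl
  tails (suc i) = coeff-*-+ᴾ p i q s

coeff-*-[] : ∀ p i → coeff (p *ᴾ []) i ≡ false
coeff-*-[] []      i       = refl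
coeff-*-[] (a ∷ p) zero    = refl
coeff-*-[] (a ∷ p) (suc i) = coeff-*-[] p i

-- Multiplication by powers of x and by the modulus

shift : ℕ → (ℕ → Bool) → ℕ → Bool
shift zero    f i       = f i
shift (suc n) f zero    = false
shift (suc n) f (suc i) = shift n f i

shift-< : ∀ {n i} f → i < n → shift n f i ≡ false
shift-< f z<s       = refl
shift-< f (s<s i<n@(s≤s _)) = shift-< f i<n

shift-+ : ∀ n f i → shift n f (n + i) ≡ f i
shift-+ zero    f i = refl
shift-+ (suc n) f i = shift-+ n f i

shift-≥ : ∀ {n i} f → n ≤ i → shift n f i ≡ f (i ∸ n)
shift-≥ f z≤n       = refl
shift-≥ f (s≤s n≤i) = shift-≥ f n≤i

coeff-x^-* : ∀ n p i → coeff (x^ n *ᴾ p) i ≡ shift n (coeff p) i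
coeff-x^-* zero p i = trans (coeff-∷-* true [] p i) (trans (cong (coeff p i xor_) (zeros i)) (xor-identityʳ _))
  where
  zeros : ∀ i → coeff (false ∷ []) i ≡ false
  zeros zero    = refl
  zeros (suc i) = refl
coeff-x^-* (suc n) p zero    = coeff-∷-* false (x^ n) p zero
coeff-x^-* (suc n) p (suc i) = trans (coeff-∷-* false (x^ n) p (suc i)) (coeff-x^-* n p i)

-- `_*ᴾ_` recurses on its left factor, so a power on the right takes a nested induction: `tails`
-- trades one factor x for one index, and `heads` shows that the constant term vanishes.
coeff-*-x^ : ∀ n p i → coeff (p *ᴾ x^ n) i ≡ shift n (coeff p) i
coeff-*-x^ zero    []      i       = refl
coeff-*-x^ zero    (a ∷ p) zero    = trans (coeff-∷-* a p (x^ 0) zero) (trans (xor-identityʳ _) (∧-identityʳ a))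
coeff-*-x^ zero    (a ∷ p) (suc i) =
  trans (coeff-∷-* a p (x^ 0) (suc i)) (cong₂ _xor_ (∧-zeroʳ a) (coeff-*-x^ zero p i))
coeff-*-x^ (suc n) p zero    = heads p
  where
  heads : ∀ p → coeff (p *ᴾ x^ suc n) 0 ≡ false
  heads []      = refl
  heads (a ∷ p) = trans (coeff-∷-* a p (x^ suc n) 0) (trans (xor-identityʳ _) (∧-zeroʳ a))
coeff-*-x^ (suc n) p (suc i) = trans (tails p i) (coeff-*-x^ n p i)
  where
  tails : ∀ p i → coeff (p *ᴾ x^ suc n) (suc i) ≡ coeff (p *ᴾ x^ n) i
  tails []      i = refl
  tails (a ∷ p) i = begin
    coeff ((a ∷ p) *ᴾ x^ suc n) (suc i)                  ≡⟨ coeff-∷-* a p (x^ suc n) (suc i) ⟩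
    (a ∧ coeff (x^ n) i) xor coeff (p *ᴾ x^ suc n) i     ≡⟨ cong ((a ∧ coeff (x^ n) i) xor_) (next i) ⟩
    (a ∧ coeff (x^ n) i) xor coeff (false ∷ p *ᴾ x^ n) i ≡⟨ coeff-∷-* a p (x^ n) i ⟨
    coeff ((a ∷ p) *ᴾ x^ n) i                            ∎
    where
    open ≡-Reasoning
    next : ∀ i → coeff (p *ᴾ x^ suc n) i ≡ coeff (false ∷ p *ᴾ x^ n) i
    next zero    = coeff-*-x^ (suc n) p zero
    next (suc i) = tails p i

coeff-x^-refl : ∀ n → coeff (x^ n) n ≡ true
coeff-x^-refl zero    = refl
coeff-x^-refl (suc n) = coeff-x^-refl n

coeff-x^-≢ : ∀ n i → i ≢ n → coeff (x^ n) i ≡ false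
coeff-x^-≢ zero    zero    i≢n = contradiction refl i≢n
coeff-x^-≢ zero    (suc i) i≢n = refl
coeff-x^-≢ (suc n) zero    i≢n = refl
coeff-x^-≢ (suc n) (suc i) i≢n = coeff-x^-≢ n i (i≢n ∘ cong suc)

coeff-*-modulus : ∀ {m} (T : Subset m) p i →
                  coeff (p *ᴾ modulus T) i ≡ shift m (coeff p) i xor ∑ T (λ t → shift (toℕ t) (coeff p) i)
coeff-*-modulus {m} T p i = begin
  coeff (p *ᴾ modulus T) i
    ≡⟨ coeff-*-+ᴾ p i (x^ m) _ ⟩
  coeff (p *ᴾ x^ m) i xor coeff (p *ᴾ foldOver _+ᴾ_ [] T (λ t → x^ toℕ t)) i
    ≡⟨ cong₂ _xor_ (coeff-*-x^ m p i)
         (trans (foldOver-homo (λ q → coeff (p *ᴾ q) i) (coeff-*-+ᴾ p i) (coeff-*-[] p i) T _)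
                (foldOver-cong T λ t → coeff-*-x^ (toℕ t) p i)) ⟩
  shift m (coeff p) i xor ∑ T (λ t → shift (toℕ t) (coeff p) i)
    ∎
  where open ≡-Reasoning

coeffs-V : ∀ {m i} (T : Subset m) (Y : 𝔽₂^ m) → i < m →
           coeffs (V T Y) i ≡ ∑ T (λ t → shift (toℕ t) (coeffs Y) i)
coeffs-V {i = i} T Y i<m = trans (coeffs-⨁ i T _) (foldOver-cong T λ t →
  trans (coeffs-tabulate (coeff (x^ toℕ t *ᴾ toList Y)) i<m) (coeff-x^-* (toℕ t) (toList Y) i))

-- Division with remainder of L + x^m H

coeffs-++-< : ∀ {m n i} (L : 𝔽₂^ m) (H : 𝔽₂^ n) → i < m → coeffs (L Vec.++ H) i ≡ coeffs L i
coeffs-++-< (a ∷ L) H z<s       = refl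
coeffs-++-< (a ∷ L) H (s<s i<m@(s≤s _)) = coeffs-++-< L H i<m

coeffs-++-+ : ∀ {m n} (L : 𝔽₂^ m) (H : 𝔽₂^ n) i → coeffs (L Vec.++ H) (m + i) ≡ coeffs H i
coeffs-++-+ []      H i = refl
coeffs-++-+ (a ∷ L) H i = coeffs-++-+ L H i

-- The origin of Δ: relative to x^m, multiplication by x^t reads Δ t places further on, which is the
-- action of `N^ Δ t`.
shift-+Δ : ∀ {m} (t : Fin m) f j → shift (toℕ t) f (m + j) ≡ f (j + Δ t)
shift-+Δ {m} t f j = trans (shift-≥ f (≤-trans t≤m (m≤m+n m j)))
  (cong f (trans (+-∸-comm j t≤m) (+-comm (m ∸ toℕ t) j)))
  where t≤m = <⇒≤ (toℕ<n t)

-- Multiplying (I + U)Y = H by x^m and comparing with Y·g gives x^m H = Y·g + V(Y).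
isRemainder : ∀ {m} (T : Subset m) (L H Y : 𝔽₂^ m) → addShifts T Δ (coeffs Y) ≗ coeffs H →
              IsRemainder (toList (L Vec.++ H)) (modulus T) (L ⊕ V T Y)
isRemainder {m} T L H Y Y-solves = toList Y , λ i → trans (cases i) (sym (expand i))
  where
  open ≡-Reasoning

  rhs : ℕ → Bool
  rhs i = (shift m (coeffs Y) i xor ∑ T (λ t → shift (toℕ t) (coeffs Y) i)) xor coeffs (L ⊕ V T Y) i

  expand : ∀ i → coeff (toList Y *ᴾ modulus T +ᴾ toList (L ⊕ V T Y)) i ≡ rhs i
  expand i = trans (coeff-+ᴾ i (toList Y *ᴾ modulus T) _)
                   (cong (_xor coeffs (L ⊕ V T Y) i) (coeff-*-modulus T (toList Y) i))

  -- Below degree m the leading term of g contributes nothing and the rest of Y·g equals V(Y), so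
  -- the two copies of V(Y) cancel and leave L.
  low : ∀ {i} → i < m → coeffs (L Vec.++ H) i ≡ rhs i
  low {i} i<m = begin
    coeffs (L Vec.++ H) i         ≡⟨ coeffs-++-< L H i<m ⟩
    coeffs L i                    ≡⟨ cong (_xor coeffs L i) (xor-same v) ⟨
    (v xor v) xor coeffs L i      ≡⟨ xor-assoc v v (coeffs L i) ⟩
    v xor (v xor coeffs L i)      ≡⟨ cong₂ _xor_ (cong (_xor v) (shift-< (coeffs Y) i<m))
                                       (trans (coeffs-⊕ i L (V T Y))
                                              (trans (xor-comm (coeffs L i) _)
                                                     (cong (_xor coeffs L i) (coeffs-V T Y i<m)))) ⟨
    rhs i                         ∎
    where v = ∑ T (λ t → shift (toℕ t) (coeffs Y) i)

  -- From degree m on, L + V(Y) has no coefficients and Y·g reads off (I + U)Y, which is H.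
  high : ∀ j → coeffs (L Vec.++ H) (m + j) ≡ rhs (m + j)
  high j = begin
    coeffs (L Vec.++ H) (m + j)     ≡⟨ coeffs-++-+ L H j ⟩
    coeffs H j                      ≡⟨ Y-solves j ⟨
    addShifts T Δ (coeffs Y) j      ≡⟨ cong₂ _xor_ (shift-+ m (coeffs Y) j)
                                         (foldOver-cong T λ t → shift-+Δ t (coeffs Y) j) ⟨
    quotient                        ≡⟨ xor-identityʳ quotient ⟨
    quotient xor false              ≡⟨ cong (quotient xor_) (coeffs-≥ (L ⊕ V T Y) (m≤m+n m j)) ⟨
    rhs (m + j)                     ∎
    where quotient = shift m (coeffs Y) (m + j) xor ∑ T (λ t → shift (toℕ t) (coeffs Y) (m + j))

  cases : ∀ i → coeffs (L Vec.++ H) i ≡ rhs i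
  cases i with i <? m
  ... | yes i<m = low i<m
  ... | no  i≮m = subst (λ i → coeffs (L Vec.++ H) i ≡ rhs i) (m+[n∸m]≡n (≮⇒≥ i≮m)) (high (i ∸ m))

-- The number of stages

-- Cross-multiplication; with n = 2 ^ k this moves the bounds of `IsCeilLog₂` from rationals to
-- naturals.
/≤/1⇒≤ : ∀ m d .{{_ : NonZero d}} n → ℤ.+ m ℚᵘ./ d ℚᵘ.≤ ℤ.+ n ℚᵘ./ 1 → m ≤ n * d
/≤/1⇒≤ m (suc d) n (*≤* m≤nd) = ℤ.drop‿+≤+ (subst (ℤ.+ m ℤ.≤_) (sym (ℤ.pos-* n (suc d)))
  (subst (ℤ._≤ ℤ.+ n ℤ.* ℤ.+ suc d) (ℤ.*-identityʳ (ℤ.+ m)) m≤nd))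

≤⇒/≤/1 : ∀ m d .{{_ : NonZero d}} n → m ≤ n * d → ℤ.+ m ℚᵘ./ d ℚᵘ.≤ ℤ.+ n ℚᵘ./ 1
≤⇒/≤/1 m (suc d) n m≤nd = *≤* (subst (ℤ._≤ ℤ.+ n ℤ.* ℤ.+ suc d) (sym (ℤ.*-identityʳ (ℤ.+ m)))
  (subst (ℤ.+ m ℤ.≤_) (ℤ.pos-* n (suc d)) (ℤ.+≤+ m≤nd)))

-- Entry t ∸ 1 of U applied to the last unit vector is 1 for every nonzero t ∈ T.
isZero-U⇒≤Δ : ∀ {m} (T : Subset m) → IsZero (U T) → ∀ {t} → t ∈ T → m ≤ Δ t
isZero-U⇒≤Δ {suc m} T U≡0 {zero}  t∈T = ≤-refl
isZero-U⇒≤Δ {suc m} T U≡0 {suc t} t∈T = contradiction (trans (sym entry≡true) entry≡false) λ ()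
  where
  e : 𝔽₂^ suc m
  e = (x^ m) modx^ suc m

  e-≢ : ∀ i → i ≢ m → coeffs e i ≡ false
  e-≢ i i≢m with i <? suc m
  ... | yes i<1+m = trans (coeffs-tabulate (coeff (x^ m)) i<1+m) (coeff-x^-≢ m i i≢m)
  ... | no  i≮1+m = coeffs-≥ e (≮⇒≥ i≮1+m)

  -- Distinct s have distinct shifts, so only the summand of `suc t` can hit the unit entry m.
  shifted : ∀ {s : Fin (suc m)} → toℕ t + Δ s ≡ m → s ≡ suc t
  shifted {s} eq = toℕ-injective (sym (+-cancelʳ-≡ (Δ s) (suc (toℕ t)) (toℕ s)
    (trans (cong suc eq) (sym (m+[n∸m]≡n (<⇒≤ (toℕ<n s)))))))

  entry≡true : coeffs (U T e) (toℕ t) ≡ true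
  entry≡true = trans (coeffs-⨁ (toℕ t) T _)
    (∑-single t∈T
      -- `m ∸ toℕ t` is `Δ (suc t)`, so this summand reads entry m of `e`.
      (trans (coeffs-N (m ∸ toℕ t) e (toℕ t))
             (trans (cong (coeffs e) (m+[n∸m]≡n (<⇒≤ (toℕ<n t))))
                    (trans (coeffs-tabulate (coeff (x^ m)) (n<1+n m)) (coeff-x^-refl m))))
      (λ s s≢1+t → trans (coeffs-N (Δ s) e (toℕ t)) (e-≢ (toℕ t + Δ s) (s≢1+t ∘ shifted))))

  entry≡false : coeffs (U T e) (toℕ t) ≡ false
  entry≡false = trans (cong (λ y → coeffs y (toℕ t)) (U≡0 e)) (coeffs-𝟎 (suc m) (toℕ t))

if-does-absorb : ∀ {P A : Set} {x y : A} (P? : Dec P) → (P → y ≡ x) → (if does P? then x else y) ≡ y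
if-does-absorb (yes p) y≡x = sym (y≡x p)
if-does-absorb (no _)  y≡x = refl

r≡⌈log₂ᵘ⌉ : ∀ {m} .{{_ : NonZero m}} (T : Subset m) → r T ≡ ⌈log₂ᵘ m/Δmin T ⌉
r≡⌈log₂ᵘ⌉ {m} T = if-does-absorb (isZero? (U T)) λ U≡0 →
  -- The ratio is at most 1 = 2 ^ 0, so exponent 0 already meets the bound and leastness forces the
  -- ceiling to be 0.
  n≤0⇒n≡0 (proj₂ (proj₂ (ceilLog₂ (m/Δmin T))) 0
    (≤⇒/≤/1 m (Δmin T) {{Δmin-nonZero T}} 1
      -- Here `≤-refl` compares m with the default value of `Δmin`, which covers empty T.
      (≤-trans (foldOver-⊓-glb T ≤-refl (isZero-U⇒≤Δ T U≡0)) (m≤m+n _ 0))))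

-- This is U^(2^r) = 0 in terms of exponents: the ceiling bounds m by 2^r Δmin, and Δmin is at most
-- every Δ t.
m≤2^r*Δ : ∀ {m} .{{_ : NonZero m}} {T : Subset m} {t} → t ∈ T → m ≤ 2 ^ r T * Δ t
m≤2^r*Δ {m} {T = T} {t} t∈T = subst (λ k → m ≤ 2 ^ k * Δ t) (sym (r≡⌈log₂ᵘ⌉ T))
  (≤-trans (/≤/1⇒≤ m (Δmin T) {{Δmin-nonZero T}} (2 ^ ℓ) (proj₁ (proj₂ (ceilLog₂ (m/Δmin T)))))
           (*-monoʳ-≤ (2 ^ ℓ) (foldOver-⊓-≤ t∈T)))
  where ℓ = ⌈log₂ᵘ m/Δmin T ⌉

feedbackDepth≡r : ∀ {m} .{{_ : NonZero m}} (T : Subset m) → feedbackDepth (frobenius T) ≡ r T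
feedbackDepth≡r T = trans (length-map _ (upTo (r T))) (length-upTo (r T))

-- The two denominators carry separate proofs of being nonzero; these are irrelevant, so equal
-- denominators give equal fractions.
m/Δmin-cong : ∀ {m} .{{_ : NonZero m}} (T T′ : Subset m) → Δmin T ≡ Δmin T′ → m/Δmin T ≡ m/Δmin T′
m/Δmin-cong {m} T T′ = /-cong {{Δmin-nonZero T}} {{Δmin-nonZero T′}}
  where
  /-cong : ∀ {d d′} .{{_ : NonZero d}} .{{_ : NonZero d′}} → d ≡ d′ → ℤ.+ m ℚᵘ./ d ≡ ℤ.+ m ℚᵘ./ d′
  /-cong refl = refl

-- Correctness of the algorithm

exponent : ∀ {m} → ℕ → Fin m → ℕ
exponent k t = 2 ^ k * Δ t

stage : ∀ {m} → Subset m → ℕ → 𝔽₂^ m → 𝔽₂^ m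
stage T k Y = Y ⊕ foldOver _⊕_ 𝟎 (T[ k ] T) (λ t → (N^ (2 ^ k * Δ t)) Y)

-- Stopping after k stages allows induction on k; at k = `r T` this is the final register of
-- `frobenius T`.
register : ∀ {m} → Subset m → ℕ → 𝔽₂^ m → 𝔽₂^ m
register T k H = foldl (λ Y f → f Y) H (map (stage T) (upTo k))

register-suc : ∀ {m} (T : Subset m) k H → register T (suc k) H ≡ stage T k (register T k H)
register-suc T k H = begin
  register T (suc k) H
    ≡⟨ cong (λ ks → foldl (λ Y f → f Y) H (map (stage T) ks)) (upTo-∷ʳ k) ⟨
  foldl (λ Y f → f Y) H (map (stage T) (upTo k ∷ʳ k))
    ≡⟨ cong (foldl (λ Y f → f Y) H) (map-++ (stage T) (upTo k) (k ∷ [])) ⟩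
  foldl (λ Y f → f Y) H (map (stage T) (upTo k) ∷ʳ stage T k)
    ≡⟨ foldl-∷ʳ (λ Y f → f Y) H (stage T k) (map (stage T) (upTo k)) ⟩
  stage T k (register T k H)
    ∎
  where open ≡-Reasoning

-- The shifts dropped from T[ k ] T vanish, so a stage is I + U^(2^k).
coeffs-stage : ∀ {m} (T : Subset m) k Y → coeffs (stage T k Y) ≗ addShifts T (exponent k) (coeffs Y)
coeffs-stage {m} T k Y i = trans (coeffs-⊕ i Y _) (cong (coeffs Y i xor_) (begin
  coeffs (foldOver _⊕_ 𝟎 (T[ k ] T) (λ t → (N^ exponent k t) Y)) i
    ≡⟨ coeffs-⨁ i (T[ k ] T) _ ⟩
  ∑ (T[ k ] T) (λ t → coeffs ((N^ exponent k t) Y) i)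
    ≡⟨ foldOver-cong (T[ k ] T) (λ t → coeffs-N (exponent k t) Y i) ⟩
  ∑ (T[ k ] T) (λ t → coeffs Y (i + exponent k t))
    ≡⟨ ∑-filter T (λ t → ⌊ exponent k t <? m ⌋) dropped ⟩
  ∑ T (λ t → coeffs Y (i + exponent k t))
    ∎))
  where
  open ≡-Reasoning
  dropped : ∀ t → ⌊ exponent k t <? m ⌋ ≡ false → coeffs Y (i + exponent k t) ≡ false
  dropped t _ with exponent k t <? m
  ... | no e≮m = coeffs-≥ Y (≤-trans (≮⇒≥ e≮m) (m≤n+m _ i))

exponent-suc : ∀ {m} k (t : Fin m) → exponent k t + exponent k t ≡ exponent (suc k) t
exponent-suc k t = trans (sym (*-distribʳ-+ (Δ t) (2 ^ k) (2 ^ k)))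
  (cong (λ n → (2 ^ k + n) * Δ t) (sym (+-identityʳ (2 ^ k))))

-- (I + U) Π_{j<k} (I + U^(2^j)) = I + U^(2^k)
register-telescopes : ∀ {m} (T : Subset m) k H →
                      addShifts T Δ (coeffs (register T k H)) ≗ addShifts T (exponent k) (coeffs H)
register-telescopes T zero H = addShifts-cong-e T (coeffs H) λ t → sym (+-identityʳ (Δ t))
register-telescopes T (suc k) H i = begin
  addShifts T Δ (coeffs (register T (suc k) H)) i
    ≡⟨ cong (λ Y → addShifts T Δ (coeffs Y) i) (register-suc T k H) ⟩
  addShifts T Δ (coeffs (stage T k Y)) i
    ≡⟨ addShifts-cong T Δ (coeffs-stage T k Y) i ⟩
  addShifts T Δ (addShifts T (exponent k) (coeffs Y)) i
    -- Moving I + U inside lets the induction hypothesis act on `register T k H`; two equal factors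
    -- then remain to be squared.
    ≡⟨ addShifts-comm T Δ (exponent k) (coeffs Y) i ⟩
  addShifts T (exponent k) (addShifts T Δ (coeffs Y)) i
    ≡⟨ addShifts-cong T (exponent k) (register-telescopes T k H) i ⟩
  addShifts T (exponent k) (addShifts T (exponent k) (coeffs H)) i
    ≡⟨ addShifts-square T (exponent k) (coeffs H) i ⟩
  addShifts T (λ t → exponent k t + exponent k t) (coeffs H) i
    ≡⟨ addShifts-cong-e T (coeffs H) (exponent-suc k) i ⟩
  addShifts T (exponent (suc k)) (coeffs H) i
    ∎
  where
  open ≡-Reasoning
  Y = register T k H

-- At k = `r T` the telescoped operator is I + U^(2^r) = I, so the final register solves (I + U)Y =
-- H.
frobenius-correct : ∀ {m} .{{_ : NonZero m}} (T : Subset m) (L H : 𝔽₂^ m) →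
                    IsRemainder (toList (L Vec.++ H)) (modulus T) (run (frobenius T) L H)
frobenius-correct T L H = isRemainder T L H (register T (r T) H) λ i →
  trans (register-telescopes T (r T) H i)
        (trans (cong (coeffs H i xor_) (∑-vanish T λ t∈T → coeffs-≥ H (≤-trans (m≤2^r*Δ t∈T) (m≤n+m _ i))))
               (xor-identityʳ (coeffs H i)))

-- Functions of bounded gate depth

-- XOR trees indexed by the function they compute, with d only an upper bound on depth. The
-- pointwise equations in the constructors let the function be replaced by an extensionally equal
-- one.
data HasDepth {n : ℕ} : ℕ → (Vec Bool n → Bool) → Set where
  input : ∀ {d f} i → (∀ a → lookup a i ≡ f a) → HasDepth d f
  gate  : ∀ {d f g h} → HasDepth d f → HasDepth d g → (∀ a → f a xor g a ≡ h a) → HasDepth (suc d) h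

HasDepth-mono : ∀ {n d d′} {f : Vec Bool n → Bool} → d ≤ d′ → HasDepth d f → HasDepth d′ f
HasDepth-mono d≤d′       (input i eq)  = input i eq
HasDepth-mono (s≤s d≤d′) (gate ϕ ψ eq) = gate (HasDepth-mono d≤d′ ϕ) (HasDepth-mono d≤d′ ψ) eq

HasDepth-resp : ∀ {n d} {f g : Vec Bool n → Bool} → f ≗ g → HasDepth d f → HasDepth d g
HasDepth-resp f≗g (input i eq) = input i λ a → trans (eq a) (f≗g a)
HasDepth-resp f≗g (gate ϕ ψ eq) = gate ϕ ψ λ a → trans (eq a) (f≗g a)

stagesDepth : ∀ {m} → Subset m → ℕ → ℕ
stagesDepth T k = sum (map (λ k → ⌈log₂ (1 + ∣ T[ k ] T ∣) ⌉) (upTo k))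

stagesDepth-suc : ∀ {m} (T : Subset m) k → stagesDepth T (suc k) ≡ stagesDepth T k + ⌈log₂ (1 + ∣ T[ k ] T ∣) ⌉
stagesDepth-suc T k = begin
  sum (map h (upTo (suc k)))           ≡⟨ cong (sum ∘ map h) (upTo-∷ʳ k) ⟨
  sum (map h (upTo k ∷ʳ k))            ≡⟨ cong sum (map-++ h (upTo k) (k ∷ [])) ⟩
  sum (map h (upTo k) ∷ʳ h k)          ≡⟨ sum-++ (map h (upTo k)) (h k ∷ []) ⟩
  sum (map h (upTo k)) + (h k + 0)     ≡⟨ cong (sum (map h (upTo k)) +_) (+-identityʳ (h k)) ⟩
  sum (map h (upTo k)) + h k           ∎
  where
  open ≡-Reasoning
  h : ℕ → ℕ
  h k = ⌈log₂ (1 + ∣ T[ k ] T ∣) ⌉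

-- Balanced xor trees

module _ {n : ℕ} where

  Fun : Set
  Fun = Vec Bool n → Bool

  -- Circuits have no constant wires, so the zero function is kept apart.
  ZeroOrDepth : ℕ → Fun → Set
  ZeroOrDepth d f = (∀ a → f a ≡ false) ⊎ HasDepth d f

  ZeroOrDepth-resp : ∀ {d f g} → f ≗ g → ZeroOrDepth d f → ZeroOrDepth d g
  ZeroOrDepth-resp f≗g (inj₁ f≡0) = inj₁ λ a → trans (sym (f≗g a)) (f≡0 a)
  ZeroOrDepth-resp f≗g (inj₂ ϕ)   = inj₂ (HasDepth-resp f≗g ϕ)

  xorAll : List Fun → Fun
  xorAll []       a = false
  xorAll (f ∷ fs) a = f a xor xorAll fs a

  -- One level of the balanced tree; an odd function out passes through without a gate.
  pairUp : List Fun → List Fun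
  pairUp []           = []
  pairUp (f ∷ [])     = f ∷ []
  pairUp (f ∷ g ∷ fs) = (λ a → f a xor g a) ∷ pairUp fs

  xorAll-pairUp : ∀ fs → xorAll (pairUp fs) ≗ xorAll fs
  xorAll-pairUp []           a = refl
  xorAll-pairUp (f ∷ [])     a = refl
  xorAll-pairUp (f ∷ g ∷ fs) a =
    trans (cong ((f a xor g a) xor_) (xorAll-pairUp fs a)) (xor-assoc (f a) (g a) _)

  length-pairUp : ∀ fs → length (pairUp fs) ≡ ⌈ length fs /2⌉
  length-pairUp []           = refl
  length-pairUp (f ∷ [])     = refl
  length-pairUp (f ∷ g ∷ fs) = cong suc (length-pairUp fs)

  pairUp-HasDepth : ∀ {d fs} → All (HasDepth d) fs → All (HasDepth (suc d)) (pairUp fs)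
  pairUp-HasDepth []           = []
  pairUp-HasDepth (ϕ ∷ [])     = HasDepth-mono (n≤1+n _) ϕ ∷ []
  pairUp-HasDepth (ϕ ∷ ψ ∷ ϕs) = gate ϕ ψ (λ _ → refl) ∷ pairUp-HasDepth ϕs

  -- Induction on the number k of levels: `pairUp` costs one level and halves the length, lowering
  -- the rounded-up logarithm by one. The list must be nonempty because the empty xor is constant.
  xorAll-HasDepth : ∀ k {d} fs → 0 < length fs → ⌈log₂ length fs ⌉ ≤ k →
                    All (HasDepth d) fs → HasDepth (d + k) (xorAll fs)
  xorAll-HasDepth k (f ∷ []) _ _ (ϕ ∷ []) =
    HasDepth-resp (λ a → sym (xor-identityʳ (f a))) (HasDepth-mono (m≤m+n _ k) ϕ)
  -- At least two functions remain, so the logarithm is at least ⌈log₂ 2⌉ = 1.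
  xorAll-HasDepth zero (f ∷ g ∷ fs) _ log≤0 ϕs =
    contradiction (≤-trans (⌈log₂⌉-mono-≤ (s≤s (s≤s (z≤n {length fs})))) log≤0) λ ()
  xorAll-HasDepth (suc k) {d} fs@(f ∷ g ∷ fs′) _ log≤1+k ϕs =
    HasDepth-resp (xorAll-pairUp fs)
      (subst (λ d → HasDepth d (xorAll (pairUp fs))) (sym (+-suc d k))
        (xorAll-HasDepth k (pairUp fs) z<s log≤k (pairUp-HasDepth ϕs)))
    where
    log≤k : ⌈log₂ length (pairUp fs) ⌉ ≤ k
    log≤k rewrite length-pairUp fs | ⌈log₂⌈n/2⌉⌉≡⌈log₂n⌉∸1 (length fs) = ∸-monoˡ-≤ 1 log≤1+k

  -- Terms known to be zero are dropped from the list, since no wire carries them; hence its length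
  -- is only bounded by the size of `S`.
  nonzeroTerms : ∀ {m d} (S : Subset m) {f : Fin m → Fun} → (∀ t → ZeroOrDepth d (f t)) →
                 ∃ λ fs → All (HasDepth d) fs × length fs ≤ ∣ S ∣ × (∀ a → xorAll fs a ≡ ∑ S (λ t → f t a))
  nonzeroTerms []            ϕs = [] , [] , z≤n , λ _ → refl
  nonzeroTerms (outside ∷ S) ϕs = nonzeroTerms S (ϕs ∘ suc)
  nonzeroTerms (inside  ∷ S) {f} ϕs with ϕs zero | nonzeroTerms S (ϕs ∘ suc)
  ... | inj₁ f≡0 | fs , ψs , len , eq = fs , ψs , m≤n⇒m≤1+n len , λ a → cong₂ _xor_ (sym (f≡0 a)) (eq a)
  ... | inj₂ ϕ   | fs , ψs , len , eq = f zero ∷ fs , ϕ ∷ ψs , s≤s len , λ a → cong (f zero a xor_) (eq a)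

  -- The term `g` keeps the list of summands nonempty and accounts for the 1 in 1 + ∣ S ∣.
  xor-∑-HasDepth : ∀ {m d} (S : Subset m) {g} {f : Fin m → Fun} → HasDepth d g → (∀ t → ZeroOrDepth d (f t)) →
                   HasDepth (d + ⌈log₂ (1 + ∣ S ∣) ⌉) (λ a → g a xor ∑ S (λ t → f t a))
  xor-∑-HasDepth S {g} ϕ ϕs with fs , ψs , len , eq ← nonzeroTerms S ϕs =
    HasDepth-resp (λ a → cong (g a xor_) (eq a))
      (xorAll-HasDepth _ (g ∷ fs) z<s (⌈log₂⌉-mono-≤ (s≤s len)) (ϕ ∷ ψs))

  -- Depth of the stages and of the output

  VecDepth : ∀ {m} → ℕ → (Vec Bool n → 𝔽₂^ m) → Set
  VecDepth d F = ∀ i → HasDepth d (λ a → lookup (F a) i)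

  coeffs-ZeroOrDepth : ∀ {m d} (F : Vec Bool n → 𝔽₂^ m) → VecDepth d F → ∀ j →
                       ZeroOrDepth d (λ a → coeffs (F a) j)
  coeffs-ZeroOrDepth {m} F ϕ j with j <? m
  ... | no  j≮m = inj₁ λ a → coeffs-≥ (F a) (≮⇒≥ j≮m)
  ... | yes j<m = inj₂ (HasDepth-resp
    (λ a → trans (sym (coeffs-toℕ (F a) (fromℕ< j<m))) (cong (coeffs (F a)) (toℕ-fromℕ< j<m)))
    (ϕ (fromℕ< j<m)))

  stage-VecDepth : ∀ {m d} (T : Subset m) k F → VecDepth d F →
                   VecDepth (d + ⌈log₂ (1 + ∣ T[ k ] T ∣) ⌉) (stage T k ∘ F)
  stage-VecDepth T k F ϕ i =
    HasDepth-resp (λ a → sym (lookup-⊕-⨁ (T[ k ] T) (F a) _ i))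
      (xor-∑-HasDepth (T[ k ] T) (ϕ i) λ t →
        ZeroOrDepth-resp (λ a → sym (lookup∘tabulate _ i)) (coeffs-ZeroOrDepth F ϕ (toℕ i + exponent k t)))

  register-VecDepth : ∀ {m} (T : Subset m) k F → VecDepth 0 F → VecDepth (stagesDepth T k) (register T k ∘ F)
  register-VecDepth T zero    F ϕ = ϕ
  register-VecDepth T (suc k) F ϕ i =
    subst (λ d → HasDepth d (λ a → lookup (register T (suc k) (F a)) i)) (sym (stagesDepth-suc T k))
      (HasDepth-resp (λ a → cong (λ y → lookup y i) (sym (register-suc T k (F a))))
        (stage-VecDepth T k (register T k ∘ F) (register-VecDepth T k F ϕ) i))

  output-VecDepth : ∀ {m d} (T : Subset m) F G → VecDepth d F → VecDepth d G →
                    VecDepth (d + ⌈log₂ (1 + ∣ T ∣) ⌉) (λ a → F a ⊕ V T (G a))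
  output-VecDepth {d = d} T F G ϕ ψ i =
    HasDepth-resp (λ a → sym (lookup-⊕-⨁ T (F a) _ i))
      (xor-∑-HasDepth T (ϕ i) λ t →
        ZeroOrDepth-resp
          (λ a → sym (trans (lookup∘tabulate _ i) (coeff-x^-* (toℕ t) (toList (G a)) (toℕ i))))
          (shifted (toℕ t) (toℕ i)))
    where
    shifted : ∀ t j → ZeroOrDepth d (λ a → shift t (coeffs (G a)) j)
    shifted zero    j       = coeffs-ZeroOrDepth G ψ j
    shifted (suc t) zero    = inj₁ λ _ → refl
    shifted (suc t) (suc j) = shifted t j

take-VecDepth : ∀ m {n d} → VecDepth d (take m {n})
take-VecDepth (suc m) zero    = input zero λ { (a ∷ as) → refl }
-- Recursing at depth 0 leaves `input` as the only constructor, and it supplies the wire index.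
take-VecDepth (suc m) {d = d} (suc i) with take-VecDepth m {d = 0} i
... | input j eq = input (suc j) λ { (a ∷ as) → eq as }

drop-VecDepth : ∀ m {n d} → VecDepth d (drop m {n})
drop-VecDepth zero    i = input i λ _ → refl
drop-VecDepth (suc m) i with drop-VecDepth m {d = 0} i
... | input j eq = input (suc j) λ { (a ∷ as) → eq as }

frobenius-VecDepth : ∀ m .{{_ : NonZero m}} (T : Subset m) →
                     VecDepth {m + m} (stagesDepth T (r T) + ⌈log₂ (1 + ∣ T ∣) ⌉)
                              (λ A → run (frobenius T) (take m A) (drop m A))
frobenius-VecDepth m T =
  output-VecDepth T (take m) (register T (r T) ∘ drop m)
    (take-VecDepth m) (register-VecDepth T (r T) (drop m) (drop-VecDepth m))

-- Circuits realizing functions of bounded depth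

-- Extension of netlists: adding gates renumbers the old wires, so the renumbering is recorded
-- together with the preservation of values and levels.
record _⊑_ {n w w′} (gs : Gates n w) (gs′ : Gates n w′) : Set where
  field
    wire      : Fin w → Fin w′
    values-⊑ : ∀ a j → lookup (values gs′ a) (wire j) ≡ lookup (values gs a) j
    levels-⊑ : ∀ j → lookup (levels gs′) (wire j) ≡ lookup (levels gs) j

open _⊑_

⊑-refl : ∀ {n w} {gs : Gates n w} → gs ⊑ gs
⊑-refl = record { wire = λ j → j ; values-⊑ = λ _ _ → refl ; levels-⊑ = λ _ → refl }

⊑-trans : ∀ {n w₁ w₂ w₃} {gs₁ : Gates n w₁} {gs₂ : Gates n w₂} {gs₃ : Gates n w₃} →
          gs₁ ⊑ gs₂ → gs₂ ⊑ gs₃ → gs₁ ⊑ gs₃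
⊑-trans p q = record
  { wire      = wire q ∘ wire p
  ; values-⊑ = λ a j → trans (values-⊑ q a (wire p j)) (values-⊑ p a j)
  ; levels-⊑ = λ j → trans (levels-⊑ q (wire p j)) (levels-⊑ p j)
  }

⊑-gate : ∀ {n w} {gs : Gates n w} {i j} → gs ⊑ gate gs i j
⊑-gate = record { wire = suc ; values-⊑ = λ _ _ → refl ; levels-⊑ = λ _ → refl }

inputs-⊑ : ∀ {n w} (gs : Gates n w) → inputs ⊑ gs
inputs-⊑ inputs        = ⊑-refl
inputs-⊑ (gate gs i j) = ⊑-trans (inputs-⊑ gs) ⊑-gate

record Carries {n w} (gs : Gates n w) (d : ℕ) (f : Vec Bool n → Bool) : Set where
  field
    index   : Fin w
    value   : ∀ a → lookup (values gs a) index ≡ f a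
    level≤d : lookup (levels gs) index ≤ d

open Carries

Carries-⊑ : ∀ {n w w′ d f} {gs : Gates n w} {gs′ : Gates n w′} → gs ⊑ gs′ → Carries gs d f → Carries gs′ d f
Carries-⊑ p c = record
  { index   = wire p (index c)
  ; value   = λ a → trans (values-⊑ p a (index c)) (value c a)
  ; level≤d = ≤-trans (≤-reflexive (levels-⊑ p (index c))) (level≤d c)
  }

-- The second subtree is built on top of the first, so the first wire is carried along the extension
-- before the joining gate is added.
extend : ∀ {n w d f} (gs : Gates n w) → HasDepth d f →
         ∃₂ λ w′ (gs′ : Gates n w′) → gs ⊑ gs′ × Carries gs′ d f
extend gs (input i eq) = _ , gs , ⊑-refl , Carries-⊑ (inputs-⊑ gs) (record
  { index   = i
  ; value   = eq
  ; level≤d = ≤-trans (≤-reflexive (lookup-replicate i 0)) z≤n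
  })
extend gs (gate ϕ ψ eq)
  with _ , gs₁ , p₁ , c₁ ← extend gs ϕ
  with _ , gs₂ , p₂ , c₂ ← extend gs₁ ψ =
  _ , gate gs₂ (index c₁′) (index c₂) , ⊑-trans p₁ (⊑-trans p₂ ⊑-gate) , record
  { index   = zero
  ; value   = λ a → trans (cong₂ _xor_ (value c₁′ a) (value c₂ a)) (eq a)
  ; level≤d = s≤s (⊔-lub (level≤d c₁′) (level≤d c₂))
  }
  where c₁′ = Carries-⊑ p₂ c₁

extendAll : ∀ {n w d o} {f : Fin o → Vec Bool n → Bool} (gs : Gates n w) → (∀ i → HasDepth d (f i)) →
            ∃₂ λ w′ (gs′ : Gates n w′) → gs ⊑ gs′ × (∀ i → Carries gs′ d (f i))
extendAll {o = zero}  gs ϕ = _ , gs , ⊑-refl , λ ()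
extendAll {o = suc o} gs ϕ
  with _ , gs₁ , p₁ , c  ← extend gs (ϕ zero)
  with _ , gs₂ , p₂ , cs ← extendAll gs₁ (ϕ ∘ suc) =
  _ , gs₂ , ⊑-trans p₁ p₂ , λ { zero → Carries-⊑ p₂ c ; (suc i) → cs i }

foldr-⊔-lub : ∀ {n d} (v : Vec ℕ n) → (∀ i → lookup v i ≤ d) → Vec.foldr′ _⊔_ 0 v ≤ d
foldr-⊔-lub []      v≤d = z≤n
foldr-⊔-lub (a ∷ v) v≤d = ⊔-lub (v≤d zero) (foldr-⊔-lub v (v≤d ∘ suc))

circuit : ∀ {n o d} (F : Vec Bool n → Vec Bool o) → VecDepth d F →
          ∃ λ (C : Circuit n o) → eval C ≗ F × depth C ≤ d
circuit F ϕ with _ , gs , _ , cs ← extendAll inputs ϕ =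
  record { gates = gs ; outputs = tabulate (index ∘ cs) } ,
  (λ a → vec-ext λ i → trans (lookup-outputs (values gs a) i) (value (cs i) a)) ,
  foldr-⊔-lub (Vec.map (lookup (levels gs)) (tabulate (index ∘ cs))) λ i → ≤-trans (≤-reflexive (lookup-outputs (levels gs) i)) (level≤d (cs i))
  where
  lookup-outputs : ∀ {A : Set} (v : Vec A _) i →
                   lookup (Vec.map (lookup v) (tabulate (index ∘ cs))) i ≡ lookup v (index (cs i))
  lookup-outputs v i = trans (lookup-map i (lookup v) (tabulate (index ∘ cs))) (cong (lookup v) (lookup∘tabulate (index ∘ cs) i))

-- The reduction circuit and the stated bounds

D⊕-bound : ∀ m .{{_ : NonZero m}} (T : Subset m) →
           D⊕[ T ]≤ (stagesDepth T (r T) + ⌈log₂ (1 + ∣ T ∣) ⌉)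
D⊕-bound m T with C , C≗ , depth≤ ← circuit _ (frobenius-VecDepth m T) = C , realizes , depth≤
  where
  realizes : RealizesReduction T C
  realizes A = subst (IsRemainder (toList A) (modulus T)) (sym (C≗ A))
    -- The two halves of A serve as L and H; concatenating them gives back A.
    (subst (λ B → IsRemainder (toList B) (modulus T) (run (frobenius T) (take m A) (drop m A)))
      (take++drop≡id m A) (frobenius-correct T (take m A) (drop m A)))

corollary5p2 : (m : ℕ) .{{_ : NonZero m}} (T : Subset m) →
    (¬ IsZero (U T) → feedbackDepth (frobenius T) ≡ ⌈log₂ᵘ m/Δmin T ⌉)
    × (IsZero (U T) → feedbackDepth (frobenius T) ≡ 0)
    × ((T′ : Subset m) → Nonempty T → Nonempty T′ → Δmin T ≡ Δmin T′ →
    feedbackDepth (frobenius T) ≡ feedbackDepth (frobenius T′))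
    × (D⊕[ T ]≤ (sum (map (λ k → ⌈log₂ (1 + ∣ T[ k ] T ∣) ⌉) (upTo (r T))) + ⌈log₂ (1 + ∣ T ∣) ⌉))
corollary5p2 m T =
    (λ _ → depth≡ T)
  , (λ U≡0 → trans (feedbackDepth≡r T) (r≡0 U≡0))
  -- Both depths are the same ceiling, which depends on the subset only through `Δmin`.
  , (λ T′ _ _ eq → trans (depth≡ T) (trans (cong ⌈log₂ᵘ_⌉ (m/Δmin-cong T T′ eq)) (sym (depth≡ T′))))
  , D⊕-bound m T
  where
  depth≡ : (T : Subset m) → feedbackDepth (frobenius T) ≡ ⌈log₂ᵘ m/Δmin T ⌉
  depth≡ T = trans (feedbackDepth≡r T) (r≡⌈log₂ᵘ⌉ T)

  r≡0 : IsZero (U T) → r T ≡ 0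
  r≡0 U≡0 = cong (λ b → if b then 0 else ⌈log₂ᵘ m/Δmin T ⌉) (dec-true (isZero? (U T)) U≡0)
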